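{- Let $n,m\geq 3$, let $\mathcal{T}=(t_{1},\ldots,t_{n})\in \mathcal{QS}(n)$ and $\mathcal{S}=(s_{1},\ldots,s_{m})\in \mathcal{QS}(m)$. Then $\mathcal{T}\circ_{i}\mathcal{S}\in \mathcal{QS}(n+m-1)$ for all $i\in\{1,\ldots,n\}$.
   Context: For $n\ge 3$, consider a plane convex $n$-gon whose vertices are labeled counterclockwise by $1,\ldots,n$. Given a triangulation of it (by pairwise non-crossing diagonals), let $t_i$ be the number of triangles of the triangulation incident with vertex $i$; the vector $(t_1,\ldots,t_n)$ is the quiddity sequence of the triangulation. $\mathcal{QS}(n)$ denotes the set of all quiddity sequences of triangulations of a plane convex $n$-gon. For $\mathcal{T}=(t_{1},\ldots,t_{n})$ and $\mathcal{S}=(s_{1},\ldots,s_{m})$ with $n,m\ge 3$ define, for $1\le i\le n-1$, $$\mathcal{T}\circ_{i}\mathcal{S}=(t_{1},\ldots,t_{i-1}, t_{i}+s_{1}+1,s_{2},\ldots,s_{m-1}, s_{m}+1, t_{i+1}+1,t_{i+2},\ldots,t_{n}),$$ and $$\mathcal{T}\circ_{n}\mathcal{S}=(t_{1}+1,t_{2},\ldots,t_{n-1}, t_{n}+s_{1}+1,s_{2},\ldots,s_{m-1}, s_{m}+1).$$ -}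

module Defs where

open import Data.Fin.Base using (Fin; zero; suc; toℕ; _<_)
open import Data.Fin.Properties using (_≟_; _<?_)
open import Data.Fin.Relation.Unary.Top using (view; ‵fromℕ; ‵inject₁)
open import Data.List.Base using (List; length; filter; allFin; cartesianProduct)
open import Data.Nat.Base using (ℕ; suc; _+_; _∸_)
import Data.Nat.Properties as ℕ
open import Data.Product.Base using (_×_; _,_; ∃)
open import Data.Sum.Base using (_⊎_)
open import Data.Vec.Base using (Vec; _∷_; _++_; _∷ʳ_; init; last; tabulate; cast)
open import Level using (0ℓ)
open import Relation.Binary.Core using (Rel)
open import Relation.Binary.Definitions using (Decidable)
open import Relation.Binary.PropositionalEquality.Core using (_≡_)
open import Relation.Nullary.Decidable.Core using (Dec; _×-dec_; _⊎-dec_)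
open import Relation.Nullary.Negation.Core using (¬_)
open import Relation.Unary using (Pred)

-- A convex n-gon is represented by its vertices in counterclockwise order,
-- Fin n; the vertex labelled k in the usual 1, …, n is the element k - 1.
-- A segment joining two vertices a and b is given with a < b.

module _ {n : ℕ} where

  IsSide : Rel (Fin n) 0ℓ
  IsSide a b = toℕ b ≡ suc (toℕ a) ⊎ (toℕ a ≡ 0 × suc (toℕ b) ≡ n)

  isSide? : Decidable IsSide
  isSide? a b = (toℕ b ℕ.≟ suc (toℕ a)) ⊎-dec ((toℕ a ℕ.≟ 0) ×-dec (suc (toℕ b) ℕ.≟ n))

  IsDiagonal : Rel (Fin n) 0ℓ
  IsDiagonal a b = a < b × ¬ IsSide a b

  -- By convexity, two segments meet in their interiors, without being equal,
  -- exactly when their endpoints are distinct and alternate around the polygon.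
  Crosses : (a b c d : Fin n) → Set
  Crosses a b c d = (a < c × c < b × b < d) ⊎ (c < a × a < d × d < b)

-- A maximal set of pairwise non-crossing diagonals.
record Triangulation (n : ℕ) : Set₁ where
  field
    Chosen      : Rel (Fin n) 0ℓ
    chosen?     : Decidable Chosen
    diagonal    : ∀ {a b} → Chosen a b → IsDiagonal a b
    nonCrossing : ∀ {a b c d} → Chosen a b → Chosen c d → ¬ Crosses a b c d
    maximal     : ∀ {a b} → IsDiagonal a b →
                  (∀ {c d} → Chosen c d → ¬ Crosses a b c d) → Chosen a b

  Edge : Rel (Fin n) 0ℓ
  Edge a b = IsSide a b ⊎ Chosen a b

  edge? : Decidable Edge
  edge? a b = isSide? a b ⊎-dec chosen? a b

  -- All vertices lie on the boundary of the polygon, so any three vertices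
  -- pairwise joined by edges span a triangle of the triangulation.
  IsTriangle : Pred (Fin n × Fin n × Fin n) 0ℓ
  IsTriangle (a , b , c) = (a < b × b < c) × (Edge a b × Edge b c × Edge a c)

  isTriangle? : ∀ t → Dec (IsTriangle t)
  isTriangle? (a , b , c) =
    ((a <? b) ×-dec (b <? c)) ×-dec (edge? a b ×-dec edge? b c ×-dec edge? a c)

  Incident : Fin n → Pred (Fin n × Fin n × Fin n) 0ℓ
  Incident v (a , b , c) = v ≡ a ⊎ v ≡ b ⊎ v ≡ c

  incident? : ∀ v t → Dec (Incident v t)
  incident? v (a , b , c) = (v ≟ a) ⊎-dec (v ≟ b) ⊎-dec (v ≟ c)

  triangles : List (Fin n × Fin n × Fin n)
  triangles = filter isTriangle?
    (cartesianProduct (allFin n) (cartesianProduct (allFin n) (allFin n)))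

  trianglesAt : Fin n → ℕ
  trianglesAt v = length (filter (incident? v) triangles)

  quiddity : Vec ℕ n
  quiddity = tabulate trianglesAt

QS : (n : ℕ) → Vec ℕ n → Set₁
QS n ts = ∃ λ (Δ : Triangulation n) → Triangulation.quiddity Δ ≡ ts

-- (t + s₁ + 1, s₂, …, sₘ₋₁, sₘ + 1)
block : ∀ {m} → ℕ → Vec ℕ (2 + m) → Vec ℕ (2 + m)
block t (s₁ ∷ ss) = t + s₁ + 1 ∷ (init ss ∷ʳ (last ss + 1))

-- The case i ≤ n - 1 of ∘ᵢ, for a first sequence of length n = 2 + k.
-- The cast only reorders the summands of the length.
insertInner : ∀ {k m} → Vec ℕ (2 + k) → Fin (1 + k) → Vec ℕ (2 + m) →
              Vec ℕ ((1 + k) + (2 + m))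
insertInner {k} {m} (t ∷ t′ ∷ ts) zero S =
  cast (ℕ.+-comm (2 + m) (1 + k)) (block t S ++ (t′ + 1 ∷ ts))
insertInner {suc k} (t ∷ ts) (suc i) S = t ∷ insertInner ts i S

-- The case i = n.
insertLast : ∀ {k m} → Vec ℕ (2 + k) → Vec ℕ (2 + m) → Vec ℕ ((1 + k) + (2 + m))
insertLast (t₁ ∷ ts) S = (t₁ + 1 ∷ init ts) ++ block (last ts) S

infix 6 _∘[_]_

_∘[_]_ : ∀ {n m} → Vec ℕ (3 + n) → Fin (3 + n) → Vec ℕ (3 + m) →
         Vec ℕ ((3 + n) + (3 + m) ∸ 1)
T ∘[ i ] S with view i
... | ‵fromℕ     = insertLast T S
... | ‵inject₁ j = insertInner T j S

{-# OPTIONS --safe #-}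
module Submission where

-- All insertions come from one operation: gluing two triangulated polygons
-- along a side adds the quiddities at the two identified vertices. For
-- i ≤ n - 1, T ∘ᵢ S is T glued with a triangle (quiddity (1, 1, 1)) along the
-- side joining vertices i and i + 1, and then with S along the side of this
-- triangle issuing from vertex i. For i = n, T is first glued to the triangle
-- along its side joining n and 1.

open import Data.Bool.Base using (true; false)
open import Data.Empty using (⊥)
open import Data.Fin.Base using (Fin; zero; suc; toℕ; _<_; _≤_; _↑ˡ_; _↑ʳ_; lift)
open import Data.Fin.Properties using (_≟_; _<?_; <-cmp; ≤-antisym; any?; suc-injective; toℕ<n; toℕ-injective; toℕ-↑ʳ)
open import Data.Fin.Relation.Unary.Top using (view; ‵fromℕ; ‵inject₁)
open import Data.List.Base as List using (List; []; _∷_; length; filter; map; allFin)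
import Data.List.Properties as List
open import Data.List.Membership.Propositional using (_∈_)
open import Data.List.Membership.Propositional.Properties
  using (∈-allFin; ∈-cartesianProduct⁺; ∈-filter⁺; ∈-filter⁻; ∈-map⁺; ∈-map⁻; ∈-++⁺ˡ; ∈-++⁺ʳ; ∈-++⁻)
open import Data.List.Membership.Propositional.Properties.WithK using (unique∧set⇒bag)
open import Data.List.Relation.Binary.BagAndSetEquality using (∼bag⇒↭)
open import Data.List.Relation.Binary.Permutation.Propositional using (_↭_)
open import Data.List.Relation.Binary.Permutation.Propositional.Properties using (↭-length; filter-↭)
open import Data.List.Relation.Unary.All using (universal)
open import Data.List.Relation.Unary.Unique.Propositional using (Unique)
import Data.List.Relation.Unary.Unique.Propositional.Properties as Unique
open import Data.Nat.Base using (ℕ; zero; suc; _+_; _∸_; z≤n; s≤s; z<s; s<s)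
import Data.Nat.Base as ℕ using (_≤_; _<_)
import Data.Nat.Properties as ℕ
open import Data.Product.Base as Product using (_×_; _,_; ∃; ∃₂; proj₁; proj₂)
open import Data.Sum.Base as Sum using (_⊎_; inj₁; inj₂; swap)
open import Data.Vec.Base as Vec using (Vec; []; _∷_; init; last; initLast; fromList; toList; tabulate; lookup)
import Data.Vec.Properties as Vec
open import Function.Base using (_∘_)
open import Function.Bundles using (mk⇔)
open import Level using (0ℓ)
open import Relation.Binary.Core using (Rel)
open import Relation.Binary.Definitions using (Decidable; tri<; tri≈; tri>)
open import Relation.Binary.PropositionalEquality
  using (_≡_; _≢_; refl; sym; trans; cong; cong₂; subst; subst₂; module ≡-Reasoning)
open import Relation.Nullary.Decidable.Core using (yes; no; does; ¬?; _×-dec_; _⊎-dec_)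
open import Relation.Nullary.Negation.Core using (¬_; contradiction)
import Relation.Unary as Unary
open import Defs

open Triangulation using (Edge; edge?; IsTriangle; isTriangle?; incident?; triangles; trianglesAt)

private
  variable
    k l m n : ℕ

-- Strictly monotone maps and crossing segments.

≤⇒<⊎≡ : {a b : Fin n} → a ≤ b → a < b ⊎ a ≡ b
≤⇒<⊎≡ = Sum.map₂ toℕ-injective ∘ ℕ.m≤n⇒m<n∨m≡n

StrictlyMonotone : (Fin n → Fin l) → Set
StrictlyMonotone f = ∀ {x y} → x < y → f x < f y

module _ {f : Fin n → Fin l} (f-mono : StrictlyMonotone f) where

  mono⇒reflects-< : ∀ {x y} → f x < f y → x < y
  mono⇒reflects-< {x} {y} fx<fy with <-cmp x y
  ... | tri< x<y _ _ = x<y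
  ... | tri≈ _ refl _ = contradiction fx<fy (ℕ.<-irrefl refl)
  ... | tri> _ _ y<x = contradiction (f-mono y<x) (ℕ.<-asym fx<fy)

  mono⇒injective : ∀ {x y} → f x ≡ f y → x ≡ y
  mono⇒injective {x} {y} fx≡fy with <-cmp x y
  ... | tri< x<y _ _ = contradiction (f-mono x<y) (ℕ.<-irrefl (cong toℕ fx≡fy))
  ... | tri≈ _ x≡y _ = x≡y
  ... | tri> _ _ y<x = contradiction (f-mono y<x) (ℕ.<-irrefl (cong toℕ (sym fx≡fy)))

  mono⇒reflects-Crosses : ∀ {a b c d} → Crosses (f a) (f b) (f c) (f d) → Crosses a b c d
  mono⇒reflects-Crosses = Sum.map reflect₃ reflect₃
    where
    reflect₃ : ∀ {a b c d} → f a < f b × f b < f c × f c < f d → a < b × b < c × c < d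
    reflect₃ = Product.map mono⇒reflects-< (Product.map mono⇒reflects-< mono⇒reflects-<)

  mono⇒preserves-Crosses : ∀ {a b c d} → Crosses a b c d → Crosses (f a) (f b) (f c) (f d)
  mono⇒preserves-Crosses = Sum.map map₃ map₃
    where
    map₃ : ∀ {a b c d} → a < b × b < c × c < d → f a < f b × f b < f c × f c < f d
    map₃ = Product.map f-mono (Product.map f-mono f-mono)

-- A crossing needs a vertex strictly between `a` and `b` and another strictly beyond them.
-- Consecutive vertices leave no room between, the first and the last vertex none beyond.
side-uncrossed : {a b c d : Fin n} → IsSide a b → ¬ Crosses a b c d
side-uncrossed {a = a} {c = c} (inj₁ b≡1+a) (inj₁ (a<c , c<b , _)) =
  ℕ.<-irrefl refl (ℕ.<-≤-trans c<b (subst (ℕ._≤ toℕ c) (sym b≡1+a) a<c))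
side-uncrossed {d = d} (inj₁ b≡1+a) (inj₂ (_ , a<d , d<b)) =
  ℕ.<-irrefl refl (ℕ.<-≤-trans d<b (subst (ℕ._≤ toℕ d) (sym b≡1+a) a<d))
side-uncrossed {d = d} (inj₂ (_ , b≡top)) (inj₁ (_ , _ , b<d)) =
  ℕ.<⇒≱ (toℕ<n d) (subst (ℕ._≤ toℕ d) b≡top b<d)
side-uncrossed (inj₂ (a≡0 , _)) (inj₂ (c<a , _)) = ℕ.n≮0 (subst (_ ℕ.<_) a≡0 c<a)

-- Sides and chosen diagonals as one edge relation.

module _ (Δ : Triangulation n) where

  edges-noncrossing : ∀ {a b c d} → Edge Δ a b → Edge Δ c d → ¬ Crosses a b c d
  edges-noncrossing (inj₁ ab) _         = side-uncrossed ab
  edges-noncrossing (inj₂ _)  (inj₁ cd) = side-uncrossed cd ∘ swap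
  edges-noncrossing (inj₂ ab) (inj₂ cd) = Triangulation.nonCrossing Δ ab cd

  -- Sides are edges from the outset, so `maximal` is invoked for diagonals only.
  edges-maximal : ∀ {a b} → a < b → (∀ {c d} → Edge Δ c d → ¬ Crosses a b c d) → Edge Δ a b
  edges-maximal {a} {b} a<b uncrossed with isSide? a b
  ... | yes ab = inj₁ ab
  ... | no ¬ab = inj₂ (Triangulation.maximal Δ (a<b , ¬ab) (uncrossed ∘ inj₂))

  triangles-unique : Unique (triangles Δ)
  triangles-unique = Unique.filter⁺ (isTriangle? Δ)
    (Unique.cartesianProduct⁺ (Unique.allFin⁺ n)
      (Unique.cartesianProduct⁺ (Unique.allFin⁺ n) (Unique.allFin⁺ n)))

  ∈-triangles⁺ : ∀ {t} → IsTriangle Δ t → t ∈ triangles Δ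
  ∈-triangles⁺ = ∈-filter⁺ (isTriangle? Δ)
    (∈-cartesianProduct⁺ (∈-allFin _) (∈-cartesianProduct⁺ (∈-allFin _) (∈-allFin _)))

  ∈-triangles⁻ : ∀ {t} → t ∈ triangles Δ → IsTriangle Δ t
  ∈-triangles⁻ = proj₂ ∘ ∈-filter⁻ (isTriangle? Δ)
    {xs = List.cartesianProduct (allFin n) (List.cartesianProduct (allFin n) (allFin n))}

-- A triangulation from a maximal noncrossing relation, some of whose pairs
-- may be sides.
module FromEdges
  (E : Rel (Fin n) 0ℓ) (E? : Decidable E)
  (E-noncrossing : ∀ {a b c d} → E a b → E c d → ¬ Crosses a b c d)
  (E-maximal : ∀ {a b} → a < b → (∀ {c d} → E c d → ¬ Crosses a b c d) → E a b)
  where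

  isDiagonal? : Decidable (IsDiagonal {n})
  isDiagonal? a b = (a <? b) ×-dec ¬? (isSide? a b)

  classify : ∀ {a b} → a < b → E a b → IsSide a b ⊎ (IsDiagonal a b × E a b)
  classify {a} {b} a<b ab with isSide? a b
  ... | yes side = inj₁ side
  ... | no ¬side = inj₂ ((a<b , ¬side) , ab)

  crossing⇒< : {a b c d : Fin n} → Crosses a b c d → c < d
  crossing⇒< (inj₁ (_ , c<b , b<d)) = ℕ.<-trans c<b b<d
  crossing⇒< (inj₂ (c<a , a<d , _)) = ℕ.<-trans c<a a<d

  triangulation : Triangulation n
  triangulation = record
    { Chosen      = λ a b → IsDiagonal a b × E a b
    ; chosen?     = λ a b → isDiagonal? a b ×-dec E? a b
    ; diagonal    = proj₁
    ; nonCrossing = λ ab cd → E-noncrossing (proj₂ ab) (proj₂ cd)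
    -- A pair of `E` that takes part in a crossing is ordered, hence is either a side, which crosses
    -- nothing, or a chosen diagonal. So avoiding the chosen diagonals amounts to avoiding all of
    -- `E`.
    ; maximal     = λ ab uncrossed → ab , E-maximal (proj₁ ab) λ cd crossing →
        Sum.[ (λ side → side-uncrossed side (swap crossing))
            , (λ chosen → uncrossed chosen crossing) ]′ (classify (crossing⇒< crossing) cd)
    }

-- Triangles and their counts under injective maps.

map₃ : {A B : Set} → (A → B) → A × A × A → B × B × B
map₃ f (a , b , c) = f a , f b , f c

map₃-injective : {A B : Set} {f : A → B} → (∀ {x y} → f x ≡ f y → x ≡ y) →
                 ∀ {s t} → map₃ f s ≡ map₃ f t → s ≡ t
map₃-injective f-inj {_ , _ , _} {_ , _ , _} eq =
  cong₂ _,_ (f-inj (cong proj₁ eq))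
    (cong₂ _,_ (f-inj (cong (proj₁ ∘ proj₂) eq)) (f-inj (cong (proj₂ ∘ proj₂) eq)))

module _ (Δ : Triangulation n) (Δ′ : Triangulation l)
         {f : Fin n → Fin l} (f-mono : StrictlyMonotone f) where

  IsTriangle-map⁺ : (∀ {x y} → x < y → Edge Δ x y → Edge Δ′ (f x) (f y)) →
                    ∀ {t} → IsTriangle Δ t → IsTriangle Δ′ (map₃ f t)
  IsTriangle-map⁺ edge ((a<b , b<c) , ab , bc , ac) =
    (f-mono a<b , f-mono b<c) , edge a<b ab , edge b<c bc , edge (ℕ.<-trans a<b b<c) ac

  IsTriangle-map⁻ : (∀ {x y} → x < y → Edge Δ′ (f x) (f y) → Edge Δ x y) →
                    ∀ {t} → IsTriangle Δ′ (map₃ f t) → IsTriangle Δ t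
  IsTriangle-map⁻ edge ((fa<fb , fb<fc) , ab , bc , ac) =
    (a<b , b<c) , edge a<b ab , edge b<c bc , edge (ℕ.<-trans a<b b<c) ac
    where
    a<b = mono⇒reflects-< f-mono fa<fb
    b<c = mono⇒reflects-< f-mono fb<fc

length-filter-map : {A B : Set} {P : Unary.Pred B 0ℓ} (P? : Unary.Decidable P) (f : A → B) (xs : List A) →
                    length (filter P? (map f xs)) ≡ length (filter (P? ∘ f) xs)
length-filter-map P? f []       = refl
length-filter-map P? f (x ∷ xs) with does (P? (f x))
... | true  = cong suc (length-filter-map P? f xs)
... | false = length-filter-map P? f xs

module _ (Δ : Triangulation n) (Δ′ : Triangulation l)
         (f : Fin n → Fin l) (f-inj : ∀ {x y} → f x ≡ f y → x ≡ y) where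

  imagesAt : Fin l → ℕ
  imagesAt v = length (filter (incident? Δ′ v) (map (map₃ f) (triangles Δ)))

  imagesAt-image : ∀ x → imagesAt (f x) ≡ trianglesAt Δ x
  imagesAt-image x = trans
    (length-filter-map (incident? Δ′ (f x)) (map₃ f) (triangles Δ))
    (cong length (List.filter-≐ (incident? Δ′ (f x) ∘ map₃ f) (incident? Δ x)
      ( Sum.map f-inj (Sum.map f-inj f-inj)
      , Sum.map (cong f) (Sum.map (cong f) (cong f)))
      (triangles Δ)))

  imagesAt-nonimage : ∀ {v} → (∀ x → f x ≢ v) → imagesAt v ≡ 0
  imagesAt-nonimage {v} v∉f = trans
    (length-filter-map (incident? Δ′ v) (map₃ f) (triangles Δ))
    (cong length (List.filter-none (incident? Δ′ v ∘ map₃ f)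
      (universal (λ t → Sum.[ v∉f _ ∘ sym , Sum.[ v∉f _ ∘ sym , v∉f _ ∘ sym ]′ ]′) (triangles Δ))))

-- Identifying a side of one polygon with a side of another.

Consecutive : Rel (Fin n) 0ℓ
Consecutive a b = toℕ b ≡ suc (toℕ a)

Image : (Fin n → Fin l) → Rel (Fin n) 0ℓ → Rel (Fin l) 0ℓ
Image f R a b = ∃₂ λ x y → f x ≡ a × f y ≡ b × R x y

Image-map : {f : Fin n → Fin l} {R S : Rel (Fin n) 0ℓ} → (∀ {x y} → R x y → S x y) →
            ∀ {a b} → Image f R a b → Image f S a b
Image-map R⇒S (x , y , fx , fy , xy) = x , y , fx , fy , R⇒S xy

-- How an n-gon (via φ) and an m-gon (via ψ) fill an l-gon when the side pq of
-- the first is identified with the side p′q′ of the second, the second polygon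
-- occupying the arc from φ p to φ q.
record Gluing (n m l : ℕ) : Set where
  field
    φ           : Fin n → Fin l
    ψ           : Fin m → Fin l
    φ-mono      : StrictlyMonotone φ
    ψ-mono      : StrictlyMonotone ψ
    p q         : Fin n
    p′ q′       : Fin m
    φp≡ψp′      : φ p ≡ ψ p′
    φq≡ψq′      : φ q ≡ ψ q′
    -- `Consecutive` rather than `IsSide` lets the second polygon fill an interval of labels. Gluing
    -- along the side joining the last vertex to the first is obtained by exchanging the two
    -- polygons.
    pq          : Consecutive p q
    p′q′        : IsSide p′ q′
    outside     : ∀ x → φ x ≤ φ p ⊎ φ q ≤ φ x
    inside      : ∀ y → φ p ≤ ψ y × ψ y ≤ φ q
    cover       : ∀ v → (∃ λ x → φ x ≡ v) ⊎ (∃ λ y → ψ y ≡ v)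
    consecutive : ∀ {a b} → Consecutive a b → Image φ Consecutive a b ⊎ Image ψ Consecutive a b
    bottom      : ∀ {a} → toℕ a ≡ 0 → ∃ λ x → φ x ≡ a × toℕ x ≡ 0
    top         : ∀ {b} → suc (toℕ b) ≡ l → ∃ λ x → φ x ≡ b × suc (toℕ x) ≡ n

  φ-injective : ∀ {x y} → φ x ≡ φ y → x ≡ y
  φ-injective = mono⇒injective φ-mono

  ψ-injective : ∀ {x y} → ψ x ≡ ψ y → x ≡ y
  ψ-injective = mono⇒injective ψ-mono

  p<q : p < q
  p<q = ℕ.≤-reflexive (sym pq)

  side : ∀ {a b} → IsSide a b → Image φ IsSide a b ⊎ Image ψ IsSide a b
  side (inj₁ ab) = Sum.map (Image-map inj₁) (Image-map inj₁) (consecutive ab)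
  side (inj₂ (a≡0 , b≡top)) =
    let x , φx , x≡0   = bottom a≡0
        y , φy , y≡top = top b≡top
    in inj₁ (x , y , φx , φy , inj₂ (x≡0 , y≡top))

  -- The arc from `φ p` to `φ q` contains all of `ψ` but only its two ends from `φ`, so a shared
  -- vertex is squeezed onto an end.
  common : ∀ {x u} → φ x ≡ ψ u → (x ≡ p × u ≡ p′) ⊎ (x ≡ q × u ≡ q′)
  common {x} {u} φx≡ψu with outside x | inside u
  ... | inj₁ φx≤φp | φp≤ψu , _ = inj₁ (x≡p , ψ-injective (trans (sym φx≡ψu) (trans (cong φ x≡p) φp≡ψp′)))
    where
    x≡p : x ≡ p
    x≡p = φ-injective (≤-antisym φx≤φp (subst (φ p ≤_) (sym φx≡ψu) φp≤ψu))
  ... | inj₂ φq≤φx | _ , ψu≤φq = inj₂ (x≡q , ψ-injective (trans (sym φx≡ψu) (trans (cong φ x≡q) φq≡ψq′)))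
    where
    x≡q : x ≡ q
    x≡q = φ-injective (≤-antisym (subst (_≤ φ q) (sym φx≡ψu) ψu≤φq) φq≤φx)

  -- Only two vertices are shared, so a pair lying in both parts is the identified side. This lets
  -- an edge of the glued polygon be pulled back to one part even when it comes from the other.
  common-edge : ∀ {x y u v} → φ x ≡ ψ u → φ y ≡ ψ v → x < y → IsSide x y × IsSide u v
  common-edge φx≡ψu φy≡ψv x<y with common φx≡ψu | common φy≡ψv
  ... | inj₁ (refl , refl) | inj₁ (refl , refl) = contradiction x<y (ℕ.<-irrefl refl)
  ... | inj₁ (refl , refl) | inj₂ (refl , refl) = inj₁ pq , p′q′
  ... | inj₂ (refl , refl) | inj₁ (refl , refl) = contradiction x<y (ℕ.<-asym p<q)
  ... | inj₂ (refl , refl) | inj₂ (refl , refl) = contradiction x<y (ℕ.<-irrefl refl)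

  -- Either crossing pattern puts `φ x` or `φ y` strictly between `ψ u` and `ψ v`, hence strictly
  -- inside the arc from `φ p` to `φ q`, which `outside` forbids.
  images-uncrossed : ∀ {x y u v} → ¬ Crosses (φ x) (φ y) (ψ u) (ψ v)
  images-uncrossed {y = y} {u} {v} (inj₁ (_ , u<y , y<v)) with outside y
  ... | inj₁ y≤p = ℕ.<⇒≱ u<y (ℕ.≤-trans y≤p (proj₁ (inside u)))
  ... | inj₂ q≤y = ℕ.<⇒≱ y<v (ℕ.≤-trans (proj₂ (inside v)) q≤y)
  images-uncrossed {x = x} {u = u} {v} (inj₂ (u<x , x<v , _)) with outside x
  ... | inj₁ x≤p = ℕ.<⇒≱ u<x (ℕ.≤-trans x≤p (proj₁ (inside u)))
  ... | inj₂ q≤x = ℕ.<⇒≱ x<v (ℕ.≤-trans (proj₂ (inside v)) q≤x)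

-- The glued triangulation and its triangles.

module Glued (G : Gluing n m l) (Δ₁ : Triangulation n) (Δ₂ : Triangulation m) where
  open Gluing G

  -- All edges are carried over, sides included: this is how the identified side, in general a
  -- diagonal of the larger polygon, becomes an edge.
  E₁ E₂ E : Rel (Fin l) 0ℓ
  E₁ = Image φ (Edge Δ₁)
  E₂ = Image ψ (Edge Δ₂)
  E a b = E₁ a b ⊎ E₂ a b

  E? : Decidable E
  E? a b =
    any? (λ x → any? λ y → (φ x ≟ a) ×-dec (φ y ≟ b) ×-dec edge? Δ₁ x y) ⊎-dec
    any? (λ x → any? λ y → (ψ x ≟ a) ×-dec (ψ y ≟ b) ×-dec edge? Δ₂ x y)

  E-noncrossing : ∀ {a b c d} → E a b → E c d → ¬ Crosses a b c d
  E-noncrossing (inj₁ (_ , _ , refl , refl , xy)) (inj₁ (_ , _ , refl , refl , uv)) =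
    edges-noncrossing Δ₁ xy uv ∘ mono⇒reflects-Crosses φ-mono
  E-noncrossing (inj₁ (_ , _ , refl , refl , _)) (inj₂ (_ , _ , refl , refl , _)) =
    images-uncrossed
  E-noncrossing (inj₂ (_ , _ , refl , refl , _)) (inj₁ (_ , _ , refl , refl , _)) =
    images-uncrossed ∘ swap
  E-noncrossing (inj₂ (_ , _ , refl , refl , xy)) (inj₂ (_ , _ , refl , refl , uv)) =
    edges-noncrossing Δ₂ xy uv ∘ mono⇒reflects-Crosses ψ-mono

  Uncrossed : Rel (Fin l) 0ℓ
  Uncrossed a b = ∀ {c d} → E c d → ¬ Crosses a b c d

  E-maximal-φφ : ∀ {x y} → φ x < φ y → Uncrossed (φ x) (φ y) → E (φ x) (φ y)
  E-maximal-φφ x<y uncrossed = inj₁ (_ , _ , refl , refl ,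
    edges-maximal Δ₁ (mono⇒reflects-< φ-mono x<y) λ uv →
      uncrossed (inj₁ (_ , _ , refl , refl , uv)) ∘ mono⇒preserves-Crosses φ-mono)

  E-maximal-ψψ : ∀ {x y} → ψ x < ψ y → Uncrossed (ψ x) (ψ y) → E (ψ x) (ψ y)
  E-maximal-ψψ x<y uncrossed = inj₂ (_ , _ , refl , refl ,
    edges-maximal Δ₂ (mono⇒reflects-< ψ-mono x<y) λ uv →
      uncrossed (inj₂ (_ , _ , refl , refl , uv)) ∘ mono⇒preserves-Crosses ψ-mono)

  E-pq : E (φ p) (φ q)
  E-pq = inj₁ (_ , _ , refl , refl , inj₁ (inj₁ pq))

  -- A segment between the interiors of the two parts would cross pq.
  E-maximal-φψ : ∀ {x y} → φ x < ψ y → Uncrossed (φ x) (ψ y) → E (φ x) (ψ y)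
  E-maximal-φψ {x} {y} x<y uncrossed with outside x
  ... | inj₂ q≤x = contradiction (ℕ.≤-trans (proj₂ (inside y)) q≤x) (ℕ.<⇒≱ x<y)
  -- If one of the comparisons is an equality, an endpoint lies on the identified side and both
  -- endpoints belong to one part. Three strict inequalities give a crossing.
  ... | inj₁ x≤p with ≤⇒<⊎≡ x≤p | ≤⇒<⊎≡ (proj₁ (inside y)) | ≤⇒<⊎≡ (proj₂ (inside y))
  ...   | inj₂ x≡p | _ | _ =
          subst (λ a → a < ψ y → Uncrossed a (ψ y) → E a (ψ y))
            (sym (trans x≡p φp≡ψp′)) E-maximal-ψψ x<y uncrossed
  ...   | inj₁ _ | inj₂ p≡y | _ =
          subst (λ b → φ x < b → Uncrossed (φ x) b → E (φ x) b) p≡y E-maximal-φφ x<y uncrossed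
  ...   | inj₁ _ | inj₁ _ | inj₂ y≡q =
          subst (λ b → φ x < b → Uncrossed (φ x) b → E (φ x) b) (sym y≡q) E-maximal-φφ x<y uncrossed
  ...   | inj₁ x<p | inj₁ p<y | inj₁ y<q = contradiction (inj₁ (x<p , p<y , y<q)) (uncrossed E-pq)

  E-maximal-ψφ : ∀ {y x} → ψ y < φ x → Uncrossed (ψ y) (φ x) → E (ψ y) (φ x)
  E-maximal-ψφ {y} {x} y<x uncrossed with outside x
  ... | inj₁ x≤p = contradiction (ℕ.≤-trans x≤p (proj₁ (inside y))) (ℕ.<⇒≱ y<x)
  ... | inj₂ q≤x with ≤⇒<⊎≡ q≤x | ≤⇒<⊎≡ (proj₁ (inside y)) | ≤⇒<⊎≡ (proj₂ (inside y))
  ...   | inj₂ q≡x | _ | _ =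
          subst (λ b → ψ y < b → Uncrossed (ψ y) b → E (ψ y) b)
            (trans (sym φq≡ψq′) q≡x) E-maximal-ψψ y<x uncrossed
  ...   | inj₁ _ | inj₂ p≡y | _ =
          subst (λ a → a < φ x → Uncrossed a (φ x) → E a (φ x)) p≡y E-maximal-φφ y<x uncrossed
  ...   | inj₁ _ | inj₁ _ | inj₂ y≡q =
          subst (λ a → a < φ x → Uncrossed a (φ x) → E a (φ x)) (sym y≡q) E-maximal-φφ y<x uncrossed
  ...   | inj₁ q<x | inj₁ p<y | inj₁ y<q = contradiction (inj₂ (p<y , y<q , q<x)) (uncrossed E-pq)

  E-maximal : ∀ {a b} → a < b → Uncrossed a b → E a b
  E-maximal {a} {b} with cover a | cover b
  ... | inj₁ (_ , refl) | inj₁ (_ , refl) = E-maximal-φφ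
  ... | inj₁ (_ , refl) | inj₂ (_ , refl) = E-maximal-φψ
  ... | inj₂ (_ , refl) | inj₁ (_ , refl) = E-maximal-ψφ
  ... | inj₂ (_ , refl) | inj₂ (_ , refl) = E-maximal-ψψ

  module F = FromEdges E E? E-noncrossing E-maximal

  Δ : Triangulation l
  Δ = F.triangulation

  Edge⇒E : ∀ {a b} → Edge Δ a b → E a b
  Edge⇒E (inj₁ ab) = Sum.map (Image-map inj₁) (Image-map inj₁) (side ab)
  Edge⇒E (inj₂ (_ , ab)) = ab

  E⇒Edge : ∀ {a b} → a < b → E a b → Edge Δ a b
  E⇒Edge = F.classify

  Edge-φ⁻ : ∀ {x y} → x < y → Edge Δ (φ x) (φ y) → Edge Δ₁ x y
  Edge-φ⁻ x<y xy with Edge⇒E xy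
  ... | inj₁ (_ , _ , φu≡φx , φv≡φy , uv) = subst₂ (Edge Δ₁) (φ-injective φu≡φx) (φ-injective φv≡φy) uv
  ... | inj₂ (_ , _ , ψu≡φx , ψv≡φy , _) = inj₁ (proj₁ (common-edge (sym ψu≡φx) (sym ψv≡φy) x<y))

  Edge-ψ⁻ : ∀ {x y} → x < y → Edge Δ (ψ x) (ψ y) → Edge Δ₂ x y
  Edge-ψ⁻ x<y xy with Edge⇒E xy
  ... | inj₂ (_ , _ , ψu≡ψx , ψv≡ψy , uv) = subst₂ (Edge Δ₂) (ψ-injective ψu≡ψx) (ψ-injective ψv≡ψy) uv
  ... | inj₁ (_ , _ , φu≡ψx , φv≡ψy , _) = inj₁ (proj₂ (common-edge φu≡ψx φv≡ψy
    (mono⇒reflects-< φ-mono (subst₂ _<_ (sym φu≡ψx) (sym φv≡ψy) (ψ-mono x<y)))))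

  IsTriangle-φ⁺ : ∀ {t} → IsTriangle Δ₁ t → IsTriangle Δ (map₃ φ t)
  IsTriangle-φ⁺ = IsTriangle-map⁺ Δ₁ Δ φ-mono λ x<y xy →
    E⇒Edge (φ-mono x<y) (inj₁ (_ , _ , refl , refl , xy))

  IsTriangle-ψ⁺ : ∀ {t} → IsTriangle Δ₂ t → IsTriangle Δ (map₃ ψ t)
  IsTriangle-ψ⁺ = IsTriangle-map⁺ Δ₂ Δ ψ-mono λ x<y xy →
    E⇒Edge (ψ-mono x<y) (inj₂ (_ , _ , refl , refl , xy))

  IsTriangle-φ⁻ : ∀ {t} → IsTriangle Δ (map₃ φ t) → IsTriangle Δ₁ t
  IsTriangle-φ⁻ = IsTriangle-map⁻ Δ₁ Δ φ-mono Edge-φ⁻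

  IsTriangle-ψ⁻ : ∀ {t} → IsTriangle Δ (map₃ ψ t) → IsTriangle Δ₂ t
  IsTriangle-ψ⁻ = IsTriangle-map⁻ Δ₂ Δ ψ-mono Edge-ψ⁻

  triple : {a b c a′ b′ c′ : Fin l} → a ≡ a′ → b ≡ b′ → c ≡ c′ → (a′ , b′ , c′) ≡ (a , b , c)
  triple refl refl refl = refl

  -- Two of the three edges come from the same part, which then contains all
  -- three vertices.
  triangle-split : ∀ {t} → IsTriangle Δ t → (∃ λ s → t ≡ map₃ φ s) ⊎ (∃ λ s → t ≡ map₃ ψ s)
  triangle-split (_ , ab , bc , ac) with Edge⇒E ab | Edge⇒E bc | Edge⇒E ac
  ... | inj₁ (_ , _ , a , b , _) | inj₁ (_ , _ , _ , c , _) | _                        = inj₁ (_ , triple a b c)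
  ... | inj₁ (_ , _ , a , b , _) | inj₂ _                   | inj₁ (_ , _ , _ , c , _) = inj₁ (_ , triple a b c)
  ... | inj₂ _                   | inj₁ (_ , _ , b , c , _) | inj₁ (_ , _ , a , _ , _) = inj₁ (_ , triple a b c)
  ... | inj₂ (_ , _ , a , b , _) | inj₂ (_ , _ , _ , c , _) | _                        = inj₂ (_ , triple a b c)
  ... | inj₂ (_ , _ , a , b , _) | inj₁ _                   | inj₂ (_ , _ , _ , c , _) = inj₂ (_ , triple a b c)
  ... | inj₁ _                   | inj₂ (_ , _ , b , c , _) | inj₂ (_ , _ , a , _ , _) = inj₂ (_ , triple a b c)

  -- The middle vertex of a triangle of the second part lies strictly inside the arc from `φ p` to
  -- `φ q`, where the first part has no vertex.
  triangle-images-disjoint : ∀ {s t} → IsTriangle Δ₂ t → map₃ φ s ≢ map₃ ψ t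
  triangle-images-disjoint {_ , y , _} {a , _ , c} ((a<b , b<c) , _) eq with outside y
  ... | inj₁ y≤p = ℕ.<⇒≱ (ψ-mono a<b)
    (ℕ.≤-trans (subst (_≤ φ p) (cong (proj₁ ∘ proj₂) eq) y≤p) (proj₁ (inside a)))
  ... | inj₂ q≤y = ℕ.<⇒≱ (ψ-mono b<c)
    (ℕ.≤-trans (proj₂ (inside c)) (subst (φ q ≤_) (cong (proj₁ ∘ proj₂) eq) q≤y))

  images₁ images₂ : List (Fin l × Fin l × Fin l)
  images₁ = map (map₃ φ) (triangles Δ₁)
  images₂ = map (map₃ ψ) (triangles Δ₂)

  -- Both lists are free of duplicates and have the same members. Their order may differ, since
  -- `triangles` enumerates by the labels of the larger polygon.
  triangles-↭ : triangles Δ ↭ images₁ List.++ images₂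
  triangles-↭ = ∼bag⇒↭ (unique∧set⇒bag (triangles-unique Δ)
    (Unique.++⁺ (Unique.map⁺ (map₃-injective φ-injective) (triangles-unique Δ₁))
                (Unique.map⁺ (map₃-injective ψ-injective) (triangles-unique Δ₂))
                disjoint)
    (mk⇔ to from))
    where
    disjoint : ∀ {t} → ¬ (t ∈ images₁ × t ∈ images₂)
    disjoint (t∈₁ , t∈₂) with ∈-map⁻ (map₃ φ) t∈₁ | ∈-map⁻ (map₃ ψ) t∈₂
    ... | _ , _ , refl | _ , s∈ , eq = triangle-images-disjoint (∈-triangles⁻ Δ₂ s∈) eq

    to : ∀ {t} → t ∈ triangles Δ → t ∈ images₁ List.++ images₂
    to t∈ with triangle-split (∈-triangles⁻ Δ t∈)
    ... | inj₁ (_ , refl) = ∈-++⁺ˡ (∈-map⁺ (map₃ φ) (∈-triangles⁺ Δ₁ (IsTriangle-φ⁻ (∈-triangles⁻ Δ t∈))))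
    ... | inj₂ (_ , refl) = ∈-++⁺ʳ images₁ (∈-map⁺ (map₃ ψ) (∈-triangles⁺ Δ₂ (IsTriangle-ψ⁻ (∈-triangles⁻ Δ t∈))))

    from : ∀ {t} → t ∈ images₁ List.++ images₂ → t ∈ triangles Δ
    from t∈ with ∈-++⁻ images₁ t∈
    ... | inj₁ t∈₁ with _ , s∈ , refl ← ∈-map⁻ (map₃ φ) t∈₁ = ∈-triangles⁺ Δ (IsTriangle-φ⁺ (∈-triangles⁻ Δ₁ s∈))
    ... | inj₂ t∈₂ with _ , s∈ , refl ← ∈-map⁻ (map₃ ψ) t∈₂ = ∈-triangles⁺ Δ (IsTriangle-ψ⁺ (∈-triangles⁻ Δ₂ s∈))

  -- Counting the triangles at each vertex.

  count₁ count₂ : Fin l → ℕ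
  count₁ = imagesAt Δ₁ Δ φ φ-injective
  count₂ = imagesAt Δ₂ Δ ψ ψ-injective

  trianglesAt-glued : ∀ v → trianglesAt Δ v ≡ count₁ v + count₂ v
  trianglesAt-glued v = begin
    length (filter (incident? Δ v) (triangles Δ))
      ≡⟨ ↭-length (filter-↭ (incident? Δ v) triangles-↭) ⟩
    length (filter (incident? Δ v) (images₁ List.++ images₂))
      ≡⟨ cong length (List.filter-++ (incident? Δ v) images₁ images₂) ⟩
    length (filter (incident? Δ v) images₁ List.++ filter (incident? Δ v) images₂)
      ≡⟨ List.length-++ (filter (incident? Δ v) images₁) ⟩
    count₁ v + count₂ v ∎
    where open ≡-Reasoning

-- `c` is `ts` carried along `f` and extended by zero. Only this much of the counts enters the
-- computation of the glued vector, which is thereby separated from the triangulations.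
Extends : (Fin n → Fin l) → Vec ℕ n → (Fin l → ℕ) → Set
Extends f ts c = (∀ x → c (f x) ≡ lookup ts x) × (∀ {v} → (∀ x → f x ≢ v) → c v ≡ 0)

QS-glued : (G : Gluing n m l) {T : Vec ℕ n} {S : Vec ℕ m} {R : Vec ℕ l} →
           (∀ c₁ c₂ → Extends (Gluing.φ G) T c₁ → Extends (Gluing.ψ G) S c₂ →
            tabulate (λ v → c₁ v + c₂ v) ≡ R) →
           QS n T → QS m S → QS l R
QS-glued G sums (Δ₁ , refl) (Δ₂ , refl) = Δ , trans (Vec.tabulate-cong trianglesAt-glued)
  (sums count₁ count₂
    ( (λ x → trans (imagesAt-image Δ₁ Δ φ φ-injective x) (sym (Vec.lookup∘tabulate (trianglesAt Δ₁) x)))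
    , imagesAt-nonimage Δ₁ Δ φ φ-injective)
    ( (λ y → trans (imagesAt-image Δ₂ Δ ψ ψ-injective y) (sym (Vec.lookup∘tabulate (trianglesAt Δ₂) y)))
    , imagesAt-nonimage Δ₂ Δ ψ ψ-injective))
  where
  open Gluing G
  open Glued G Δ₁ Δ₂

-- Concrete gluings in terms of labels.

-- The part of a gluing beyond φ p: the vertices strictly between p and q, then
-- q and the vertices after it.

inner : ∀ m k → Fin (m + 1) → Fin (m + suc k)
inner m k = lift m (_↑ˡ k)

↑ʳ-mono : ∀ m → StrictlyMonotone {n} (m ↑ʳ_)
↑ʳ-mono zero    x<y = x<y
↑ʳ-mono (suc m) x<y = s<s (↑ʳ-mono m x<y)

inner-mono : ∀ m → StrictlyMonotone (inner m k)
inner-mono zero    {zero}  {zero}  ()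
inner-mono (suc m) {zero}  {suc _} _         = z<s
inner-mono (suc m) {suc _} {suc _} (s<s x<y) = s<s (inner-mono m x<y)

inner-last : ∀ m → m ↑ʳ zero ≡ inner m k (m ↑ʳ zero)
inner-last zero    = refl
inner-last (suc m) = cong suc (inner-last m)

↑ʳ-outside : ∀ m (x : Fin (suc k)) → m ↑ʳ zero {k} ≤ m ↑ʳ x
↑ʳ-outside zero    _ = z≤n
↑ʳ-outside (suc m) x = s≤s (↑ʳ-outside m x)

inner-inside : ∀ m (y : Fin (m + 1)) → inner m k y ≤ m ↑ʳ zero {k}
inner-inside zero    zero    = z≤n
inner-inside (suc m) zero    = z≤n
inner-inside (suc m) (suc y) = s≤s (inner-inside m y)

inner-cover : ∀ m (v : Fin (m + suc k)) → (∃ λ x → m ↑ʳ x ≡ v) ⊎ (∃ λ y → inner m k y ≡ v)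
inner-cover zero    v       = inj₁ (v , refl)
inner-cover (suc m) zero    = inj₂ (zero , refl)
inner-cover (suc m) (suc v) =
  Sum.map (Product.map₂ (cong suc)) (Product.map suc (cong suc)) (inner-cover m v)

toℕ≡0⇒inner : ∀ m {b : Fin (m + suc k)} → toℕ b ≡ 0 → ∃ λ y → inner m k y ≡ b × toℕ y ≡ 0
toℕ≡0⇒inner zero    {zero} _ = zero , refl , refl
toℕ≡0⇒inner (suc m) {zero} _ = zero , refl , refl

-- The two maps overlap only at `q`: a consecutive pair starting before `q` comes from `inner`, one
-- starting at `q` or later from the tail.
inner-consecutive : ∀ m {a b : Fin (m + suc k)} → Consecutive a b →
                    Image (m ↑ʳ_) Consecutive a b ⊎ Image (inner m k) Consecutive a b
inner-consecutive zero    ab = inj₁ (_ , _ , refl , refl , ab)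
inner-consecutive (suc m) {zero} {suc b} ab =
  let y , ψy , y≡0 = toℕ≡0⇒inner m (ℕ.suc-injective ab)
  in inj₂ (zero , suc y , refl , cong suc ψy , cong suc y≡0)
inner-consecutive (suc m) {suc a} {suc b} ab = Sum.map
  (λ (x , y , fx , fy , xy) → x , y , cong suc fx , cong suc fy , xy)
  (λ (x , y , fx , fy , xy) → suc x , suc y , cong suc fx , cong suc fy , cong suc xy)
  (inner-consecutive m (ℕ.suc-injective ab))

↑ʳ-top : ∀ m {b : Fin (m + suc k)} → suc (toℕ b) ≡ m + suc k → ∃ λ x → m ↑ʳ x ≡ b × toℕ x ≡ k
↑ʳ-top zero    b≡top = _ , refl , ℕ.suc-injective b≡top
↑ʳ-top {k} (suc m) {zero} 1≡ = contradiction (trans 1≡ (cong suc (ℕ.+-suc m k))) λ ()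
↑ʳ-top (suc m) {suc b} b≡top = Product.map₂ (Product.map₁ (cong suc)) (↑ʳ-top m (ℕ.suc-injective b≡top))

-- Here `p` and `q` are the first two vertices. The second polygon places its first and last
-- vertices on them and its `m` others in between.
gluingAtZero : ∀ m k → Gluing (2 + k) (suc (m + 1)) (suc (m + suc k))
gluingAtZero m k = record
  { φ           = φ
  ; ψ           = ψ
  ; φ-mono      = lift-mono (↑ʳ-mono m)
  ; ψ-mono      = lift-mono (inner-mono m)
  ; p           = zero
  ; q           = suc zero
  ; p′          = zero
  ; q′          = suc (m ↑ʳ zero)
  ; φp≡ψp′      = refl
  ; φq≡ψq′      = cong suc (inner-last m)
  ; pq          = refl
  -- `q′` has label `m + 1`, the last of `m + 2` labels, so this is the side joining the first and
  -- last vertices.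
  ; p′q′        = inj₂ (refl , cong suc (trans (cong suc (trans (toℕ-↑ʳ m zero) (ℕ.+-identityʳ m))) (ℕ.+-comm 1 m)))
  ; outside     = λ { zero → inj₁ z≤n ; (suc x) → inj₂ (s≤s (↑ʳ-outside m x)) }
  ; inside      = λ { zero → z≤n , z≤n ; (suc y) → z≤n , s≤s (inner-inside m y) }
  ; cover       = λ { zero → inj₁ (zero , refl)
                    ; (suc v) → Sum.map (Product.map suc (cong suc)) (Product.map suc (cong suc)) (inner-cover m v) }
  ; consecutive = consecutive
  ; bottom      = λ { {zero} _ → zero , refl , refl }
  ; top         = top
  }
  where
  φ = lift 1 (m ↑ʳ_)
  ψ = lift 1 (inner m k)

  lift-mono : {f : Fin n → Fin l} → StrictlyMonotone f → StrictlyMonotone (lift 1 f)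
  lift-mono f-mono {zero}  {suc _} _         = z<s
  lift-mono f-mono {suc _} {suc _} (s<s x<y) = s<s (f-mono x<y)

  consecutive : ∀ {a b} → Consecutive a b → Image φ Consecutive a b ⊎ Image ψ Consecutive a b
  consecutive {zero} {suc b} ab =
    let y , ψy , y≡0 = toℕ≡0⇒inner m (ℕ.suc-injective ab)
    in inj₂ (zero , suc y , refl , cong suc ψy , cong suc y≡0)
  consecutive {suc a} {suc b} ab = Sum.map lift-image lift-image (inner-consecutive m (ℕ.suc-injective ab))
    where
    lift-image : {f : Fin n → Fin l} {a b : Fin l} →
                 Image f Consecutive a b → Image (lift 1 f) Consecutive (suc a) (suc b)
    lift-image (x , y , fx , fy , xy) = suc x , suc y , cong suc fx , cong suc fy , cong suc xy

  top : ∀ {b} → suc (toℕ b) ≡ suc (m + suc k) → ∃ λ x → φ x ≡ b × suc (toℕ x) ≡ 2 + k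
  top {zero}  1≡    = contradiction (trans 1≡ (cong suc (ℕ.+-suc m k))) λ ()
  top {suc b} b≡top =
    let x , φx , x≡q = ↑ʳ-top m (ℕ.suc-injective b≡top)
    in suc x , cong suc φx , cong suc (cong suc x≡q)

-- A new first vertex is given to the first polygon alone, and every label of the second part moves
-- up by one.
shift : Gluing n m l → Gluing (suc n) m (suc l)
shift {n} {m} {l} G = record
  { φ           = lift 1 φ
  ; ψ           = suc ∘ ψ
  ; φ-mono      = λ { {zero} {suc _} _ → z<s ; {suc _} {suc _} (s<s x<y) → s<s (φ-mono x<y) }
  ; ψ-mono      = s<s ∘ ψ-mono
  ; p           = suc p
  ; q           = suc q
  ; p′          = p′
  ; q′          = q′
  ; φp≡ψp′      = cong suc φp≡ψp′
  ; φq≡ψq′      = cong suc φq≡ψq′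
  ; pq          = cong suc pq
  ; p′q′        = p′q′
  ; outside     = λ { zero → inj₁ z≤n ; (suc x) → Sum.map s≤s s≤s (outside x) }
  ; inside      = Product.map s≤s s≤s ∘ inside
  ; cover       = λ { zero → inj₁ (zero , refl)
                    ; (suc v) → Sum.map (Product.map suc (cong suc)) (Product.map₂ (cong suc)) (cover v) }
  ; consecutive = consecutive′
  ; bottom      = λ { {zero} _ → zero , refl , refl }
  ; top         = top′
  }
  where
  open Gluing G

  consecutive′ : ∀ {a b} → Consecutive a b →
                 Image (lift 1 φ) Consecutive a b ⊎ Image (suc ∘ ψ) Consecutive a b
  -- The new vertex is followed by the old first one, which `bottom` places in the first polygon.
  consecutive′ {zero} {suc b} ab =
    let x , φx , x≡0 = bottom (ℕ.suc-injective ab)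
    in inj₁ (zero , suc x , refl , cong suc φx , cong suc x≡0)
  consecutive′ {suc a} {suc b} ab = Sum.map
    (λ (x , y , φx , φy , xy) → suc x , suc y , cong suc φx , cong suc φy , cong suc xy)
    (λ (x , y , ψx , ψy , xy) → x , y , cong suc ψx , cong suc ψy , xy)
    (consecutive (ℕ.suc-injective ab))

  top′ : ∀ {b} → suc (toℕ b) ≡ suc l → ∃ λ x → lift 1 φ x ≡ b × suc (toℕ x) ≡ suc n
  -- Label 0 would be last only if `l` were zero, but `φ p` inhabits `Fin l`.
  top′ {zero} 1≡ with () ← subst Fin (sym (ℕ.suc-injective 1≡)) (φ p)
  top′ {suc b} b≡top =
    let x , φx , x≡top = top (ℕ.suc-injective b≡top)
    in suc x , cong suc φx , cong suc x≡top

-- There are `n` vertices before `p`, `m` strictly between `φ p` and `φ q`, and `k` after `q`.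
gluing : ∀ n m k → Gluing (n + (2 + k)) (suc (m + 1)) (n + suc (m + suc k))
gluing zero    m k = gluingAtZero m k
gluing (suc n) m k = shift (gluing n m k)

-- Quiddity vectors of the concrete gluings.

inner-sums : ∀ {t s} (M : Vec ℕ m) (B : Vec ℕ k) (c₁ c₂ : Fin (m + suc k) → ℕ) →
             Extends (m ↑ʳ_) (t ∷ B) c₁ → Extends (inner m k) (M Vec.++ s ∷ []) c₂ →
             tabulate (λ v → c₁ v + c₂ v) ≡ M Vec.++ (t + s) ∷ B
inner-sums [] B c₁ c₂ (on₁ , _) (on₂ , off₂) =
  cong₂ _∷_ (cong₂ _+_ (on₁ zero) (on₂ zero))
    -- Beyond `q` there are no vertices of the second polygon, so `c₂` vanishes.
    (trans (Vec.tabulate-cong λ v → trans (cong₂ _+_ (on₁ (suc v)) (off₂ λ { zero () })) (ℕ.+-identityʳ _))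
           (Vec.tabulate∘lookup B))
inner-sums (_ ∷ M) B c₁ c₂ (on₁ , off₁) (on₂ , off₂) =
  -- Strictly between `p` and `q` there are no vertices of the first polygon, so `c₁` vanishes.
  cong₂ _∷_ (cong₂ _+_ (off₁ λ _ ()) (on₂ zero))
    (inner-sums M B (c₁ ∘ suc) (c₂ ∘ suc)
      (on₁ , λ v∉ → off₁ λ x → v∉ x ∘ suc-injective)
      (on₂ ∘ suc , λ v∉ → off₂ λ { zero () ; (suc y) → v∉ y ∘ suc-injective }))

gluing-sums : ∀ {t t′ s s′} (A : Vec ℕ n) (B : Vec ℕ k) (M : Vec ℕ m) (c₁ c₂ : Fin (n + suc (m + suc k)) → ℕ) →
              Extends (Gluing.φ (gluing n m k)) (A Vec.++ t ∷ t′ ∷ B) c₁ →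
              Extends (Gluing.ψ (gluing n m k)) (s ∷ M Vec.++ s′ ∷ []) c₂ →
              tabulate (λ v → c₁ v + c₂ v) ≡ A Vec.++ (t + s) ∷ M Vec.++ (t′ + s′) ∷ B
gluing-sums [] B M c₁ c₂ (on₁ , off₁) (on₂ , off₂) =
  cong₂ _∷_ (cong₂ _+_ (on₁ zero) (on₂ zero))
    (inner-sums M B (c₁ ∘ suc) (c₂ ∘ suc)
      (on₁ ∘ suc , λ v∉ → off₁ λ { zero () ; (suc x) → v∉ x ∘ suc-injective })
      (on₂ ∘ suc , λ v∉ → off₂ λ { zero () ; (suc y) → v∉ y ∘ suc-injective }))
gluing-sums (_ ∷ A) B M c₁ c₂ (on₁ , off₁) (on₂ , off₂) =
  cong₂ _∷_ (trans (cong₂ _+_ (on₁ zero) (off₂ λ _ ())) (ℕ.+-identityʳ _))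
    (gluing-sums A B M (c₁ ∘ suc) (c₂ ∘ suc)
      (on₁ ∘ suc , λ v∉ → off₁ λ { zero () ; (suc x) → v∉ x ∘ suc-injective })
      (on₂ , λ v∉ → off₂ λ y → v∉ y ∘ suc-injective))

-- Gluing of quiddity sequences as lists.

-- Lists avoid transporting vectors along equations between their lengths.
QSList : List ℕ → Set₁
QSList ts = QS (length ts) (fromList ts)

-- Equal lists have equal lengths; once the sizes are unified, injectivity of `toList` identifies
-- the vectors.
QS-resp-toList : {ts : Vec ℕ n} {us : Vec ℕ m} → toList ts ≡ toList us → QS n ts → QS m us
QS-resp-toList {ts = ts} {us} eq h
  with refl ← trans (sym (Vec.length-toList ts)) (trans (cong length eq) (Vec.length-toList us)) =
  subst (QS _) (trans (sym (Vec.cast-is-id refl ts)) (Vec.toList-injective refl ts us eq)) h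

QS⇒QSList : {ts : Vec ℕ n} → QS n ts → QSList (toList ts)
QS⇒QSList = QS-resp-toList (sym (Vec.toList∘fromList _))

QSList⇒QS : {ts : Vec ℕ n} → QSList (toList ts) → QS n ts
QSList⇒QS = QS-resp-toList (Vec.toList∘fromList _)

QSList-glue : ∀ A {t t′} B {s s′} M →
              QSList (A List.++ t ∷ t′ ∷ B) → QSList (s ∷ M List.++ s′ ∷ []) →
              QSList (A List.++ (t + s) ∷ M List.++ (t′ + s′) ∷ B)
QSList-glue A B M T S = subst QSList
  (trans (toList-fromList-++ A _) (cong (λ xs → A List.++ _ ∷ xs)
    (trans (toList-fromList-++ M _) (cong (λ xs → M List.++ _ ∷ xs) (Vec.toList∘fromList B)))))
  (QS⇒QSList (QS-glued (gluing (length A) (length M) (length B))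
    (gluing-sums (fromList A) (fromList B) (fromList M))
    (QSList⇒QS (subst QSList (sym (trans (toList-fromList-++ A _)
      (cong (λ xs → A List.++ _ ∷ _ ∷ xs) (Vec.toList∘fromList B)))) T))
    (QSList⇒QS (subst QSList (sym (cong (_ ∷_) (toList-fromList-++ M _))) S))))
  where
  toList-fromList-++ : ∀ (xs : List ℕ) (ys : Vec ℕ n) → toList (fromList xs Vec.++ ys) ≡ xs List.++ toList ys
  toList-fromList-++ xs ys = trans (Vec.toList-++ (fromList xs) ys) (cong (List._++ toList ys) (Vec.toList∘fromList xs))

-- Any two vertices of a triangle are joined by a side, so the empty set of diagonals is maximal;
-- the quiddity is then found by evaluation.
QSList-triangle : QSList (1 ∷ 1 ∷ 1 ∷ [])
QSList-triangle = record
  { Chosen      = λ _ _ → ⊥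
  ; chosen?     = λ _ _ → no λ ()
  ; diagonal    = λ ()
  ; nonCrossing = λ ()
  ; maximal     = λ {a} {b} ab _ → no-diagonal a b ab
  } , refl
  where
  no-diagonal : (a b : Fin 3) → ¬ IsDiagonal a b
  no-diagonal zero             (suc zero)       (_ , ¬side) = ¬side (inj₁ refl)
  no-diagonal zero             (suc (suc zero)) (_ , ¬side) = ¬side (inj₂ (refl , refl))
  no-diagonal (suc zero)       (suc (suc zero)) (_ , ¬side) = ¬side (inj₁ refl)
  no-diagonal (suc zero)       (suc zero)       (s<s () , _)
  no-diagonal (suc (suc zero)) (suc zero)       (s<s () , _)
  no-diagonal (suc (suc zero)) (suc (suc zero)) (s<s (s<s ()) , _)

-- The two kinds of insertion.

toList-init-last : (xs : Vec ℕ (suc n)) → toList xs ≡ toList (init xs) List.++ last xs ∷ []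
toList-init-last xs = trans (cong toList (proj₂ (proj₂ (initLast xs)))) (Vec.toList-∷ʳ (last xs) (init xs))

-- In the hypothesis the triangle is already attached: it has raised `t` by one, and the entry 1 is
-- its third vertex. Gluing the ends of `S` onto these two entries yields `block`, up to the order
-- of summands.
QSList-insertBlock : ∀ A t B (S : Vec ℕ (2 + m)) →
                     QSList (A List.++ (t + 1) ∷ 1 ∷ B) → QSList (toList S) →
                     QSList (A List.++ toList (block t S) List.++ B)
QSList-insertBlock A t B (s ∷ ss) hT hS = subst QSList
  (cong (A List.++_) (cong₂ _∷_ t+1+s≡t+s+1 rest≡))
  (QSList-glue A B M hT (subst QSList (cong (s ∷_) (toList-init-last ss)) hS))
  where
  M = toList (init ss)

  t+1+s≡t+s+1 : t + 1 + s ≡ t + s + 1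
  t+1+s≡t+s+1 = trans (ℕ.+-assoc t 1 s) (trans (cong (t +_) (ℕ.+-comm 1 s)) (sym (ℕ.+-assoc t s 1)))

  rest≡ : M List.++ (1 + last ss) ∷ B ≡ toList (init ss Vec.∷ʳ (last ss + 1)) List.++ B
  rest≡ = begin
    M List.++ (1 + last ss) ∷ B                    ≡⟨ cong (λ u → M List.++ u ∷ B) (ℕ.+-comm 1 (last ss)) ⟩
    M List.++ (last ss + 1) ∷ B                    ≡⟨ List.++-assoc M (last ss + 1 ∷ []) B ⟨
    (M List.++ last ss + 1 ∷ []) List.++ B         ≡⟨ cong (List._++ B) (Vec.toList-∷ʳ (last ss + 1) (init ss)) ⟨
    toList (init ss Vec.∷ʳ (last ss + 1)) List.++ B ∎
    where open ≡-Reasoning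

-- `A` accumulates the entries already passed by the recursion, because `QSList` concerns the whole
-- sequence and does not descend to a tail.
QSList-insertInner : ∀ A (T : Vec ℕ (2 + k)) j (S : Vec ℕ (2 + m)) →
                     QSList (A List.++ toList T) → QSList (toList S) →
                     QSList (A List.++ toList (insertInner T j S))
QSList-insertInner {k} {m} A (t ∷ t′ ∷ ts) zero S hT hS = subst QSList
  (cong (A List.++_) (sym (trans (Vec.toList-cast (ℕ.+-comm (2 + m) (1 + k)) (block t S Vec.++ t′ + 1 ∷ ts))
                                 (Vec.toList-++ (block t S) (t′ + 1 ∷ ts)))))
  -- The triangle is glued along the side carrying `t` and `t′`: both gain 1, and its third vertex
  -- appears between them with entry 1.
  (QSList-insertBlock A t (t′ + 1 ∷ toList ts) S (QSList-glue A (toList ts) (1 ∷ []) hT QSList-triangle) hS)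
QSList-insertInner {suc k} A (t ∷ ts@(_ ∷ _)) (suc j) S hT hS = subst QSList
  (List.++-assoc A (t ∷ []) _)
  (QSList-insertInner (A List.++ t ∷ []) ts j S (subst QSList (sym (List.++-assoc A (t ∷ []) _)) hT) hS)

QSList-insertLast : (T : Vec ℕ (2 + k)) (S : Vec ℕ (2 + m)) →
                    QSList (toList T) → QSList (toList S) → QSList (toList (insertLast T S))
QSList-insertLast (t ∷ ts) S hT hS = subst QSList
  (trans (cong ((t + 1 ∷ M) List.++_) (List.++-identityʳ (toList (block (last ts) S))))
         (sym (Vec.toList-++ (t + 1 ∷ init ts) (block (last ts) S))))
  (QSList-insertBlock (t + 1 ∷ M) (last ts) [] S
    (subst QSList (cong₂ (λ u v → u ∷ M List.++ v ∷ 1 ∷ []) (ℕ.+-comm 1 t) (ℕ.+-comm 1 (last ts)))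
      -- The roles are exchanged: the triangle is the first polygon, `t ∷ ts` fills the arc between
      -- its first two vertices, and its third vertex comes last.
      (QSList-glue [] (1 ∷ []) M QSList-triangle
        (subst QSList (cong (t ∷_) (toList-init-last ts)) hT)))
    hS)
  where
  M = toList (init ts)

theorem1 : (n m : ℕ) (T : Vec ℕ (3 + n)) (S : Vec ℕ (3 + m)) →
    QS (3 + n) T → QS (3 + m) S →
    (i : Fin (3 + n)) → QS ((3 + n) + (3 + m) ∸ 1) (T ∘[ i ] S)
theorem1 n m T S hT hS i with view i
... | ‵fromℕ     = QSList⇒QS (QSList-insertLast T S (QS⇒QSList hT) (QS⇒QSList hS))
... | ‵inject₁ j = QSList⇒QS (QSList-insertInner [] T j S (QS⇒QSList hT) (QS⇒QSList hS))
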